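{- For formulas of the language LTL: (1) $\mathbf{AX}^{gen}$ is sound and complete with respect to $\mathcal{M}$, the class of all finite and infinite temporal structures. (2) $\mathbf{AX}^{inf}$ is sound and complete with respect to $\mathcal{M}^{inf}$, the class of infinite temporal structures. (3) $\mathbf{AX}^{fin}$ is sound and complete with respect to $\mathcal{M}^{fin}$, the class of finite temporal structures. Here "sound and complete with respect to a class $\mathcal{C}$" means: a formula is provable in the axiomatization if and only if it is true at every position of every structure in $\mathcal{C}$.
   Context: LTL formulas are built from primitive propositions $p$ in a set $\Phi_0$ by the grammar $\phi,\psi ::= p \mid \neg\phi \mid \phi\wedge\psi \mid \bigcirc\phi \mid \phi\,\mathcal{U}\,\psi$. Abbreviations: $\phi\vee\psi := \neg(\neg\phi\wedge\neg\psi)$, $\phi\Rightarrow\psi := \neg\phi\vee\psi$, $\mathit{true}$ is a fixed propositional tautology, $\mathit{false} := \neg\mathit{true}$, $\Diamond\phi := \mathit{true}\,\mathcal{U}\,\phi$, $\Box\phi := \neg\Diamond\neg\phi$, and $\overline{\bigcirc}\phi := \neg\bigcirc\neg\phi$ ("strong next"; $\bigcirc$ is "weak next"). A temporal structure is $M=(S,\sigma,\pi)$ with $S$ a set of states, $\sigma=s_0s_1\dots$ a finite (nonempty) or infinite sequence of states of $S$, and $\pi(s)\subseteq\Phi_0$ the propositions true at $s$. $M$ is finite iff $\sigma$ is finite. Positions of $\sigma$ are the indices $i$ of its elements. Truth at position $i$: $(M,i)\models p$ iff $p\in\pi(s_i)$; negation and conjunction as usual; $(M,i)\models\bigcirc\phi$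 iff $i$ is the last position of $\sigma$ (if $\sigma$ is finite) or $(M,i+1)\models\phi$; $(M,i)\models\phi\,\mathcal{U}\,\psi$ iff there is a position $j\ge i$ with $(M,j)\models\psi$ and $(M,k)\models\phi$ for all $i\le k<j$. (So $\bigcirc\mathit{false}$ holds exactly at the last position of a finite sequence.) $\mathbf{AX}^{gen}$ consists of: Prop: all instances of propositional tautologies; MP: from $\phi$ and $\phi\Rightarrow\psi$ infer $\psi$; T1: $\bigcirc\phi\wedge\bigcirc(\phi\Rightarrow\psi)\Rightarrow\bigcirc\psi$; T2': $\phi\,\mathcal{U}\,\psi\Leftrightarrow\psi\vee(\phi\wedge\overline{\bigcirc}(\phi\,\mathcal{U}\,\psi))$; T3': $\bigcirc\phi\Leftrightarrow(\bigcirc\mathit{false}\vee\overline{\bigcirc}\phi)$; RT1: from $\phi$ infer $\bigcirc\phi$; RT2: from $\phi'\Rightarrow\neg\psi\wedge\bigcirc\phi'$ infer $\phi'\Rightarrow\neg(\phi\,\mathcal{U}\,\psi)$. $\mathbf{AX}^{inf}$ is $\mathbf{AX}^{gen}$ plus the axiom Inf: $\neg\bigcirc\mathit{false}$. $\mathbf{AX}^{fin}$ is $\mathbf{AX}^{gen}$ plus the axiom Fin: $\Diamond\bigcirc\mathit{false}$. -}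

module Defs where

open import Data.Bool.Base as Bool using (Bool)
open import Data.Empty using (⊥)
open import Data.Fin.Base using (Fin; toℕ)
open import Data.Nat.Base using (ℕ; suc; _≤_; _<_)
open import Data.Product.Base using (_×_; ∃-syntax)
open import Data.Sum.Base using (_⊎_)
open import Function.Bundles using (_⇔_)
open import Level using (0ℓ)
open import Relation.Binary.PropositionalEquality.Core using (_≡_)
import Relation.Nullary.Negation.Core as Nullary
open import Relation.Unary using (Pred; _∈_; ∅; ｛_｝; U)

infix  8 ¬_ ○_
infixr 7 _𝓤_
infixr 6 _∧_

data Formula (Φ₀ : Set) : Set where
  atom : Φ₀ → Formula Φ₀
  ¬_   : Formula Φ₀ → Formula Φ₀
  _∧_  : Formula Φ₀ → Formula Φ₀ → Formula Φ₀
  ○_   : Formula Φ₀ → Formula Φ₀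
  _𝓤_  : Formula Φ₀ → Formula Φ₀ → Formula Φ₀

data PropFormula : Set where
  var : ℕ → PropFormula
  ¬_  : PropFormula → PropFormula
  _∧_ : PropFormula → PropFormula → PropFormula

eval : (ℕ → Bool) → PropFormula → Bool
eval v (var x) = v x
eval v (¬ α)   = Bool.not (eval v α)
eval v (α ∧ β) = eval v α Bool.∧ eval v β

Tautology : Pred PropFormula 0ℓ
Tautology α = ∀ v → eval v α ≡ Bool.true

module _ {Φ₀ : Set} where

  _[_] : PropFormula → (ℕ → Formula Φ₀) → Formula Φ₀
  var x   [ θ ] = θ x
  (¬ α)   [ θ ] = ¬ (α [ θ ])
  (α ∧ β) [ θ ] = (α [ θ ]) ∧ (β [ θ ])

  TautologyInstance : Pred (Formula Φ₀) 0ℓ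
  TautologyInstance φ = ∃[ α ] ∃[ θ ] Tautology α × φ ≡ α [ θ ]

  infixr 5 _∨_
  infixr 4 _⇒_
  infix  3 _⟺_

  _∨_ _⇒_ _⟺_ : Formula Φ₀ → Formula Φ₀ → Formula Φ₀
  φ ∨ ψ = ¬ (¬ φ ∧ ¬ ψ)
  φ ⇒ ψ = ¬ φ ∨ ψ
  φ ⟺ ψ = (φ ⇒ ψ) ∧ (ψ ⇒ φ)

  infix 8 ○̄_

  ○̄_ : Formula Φ₀ → Formula Φ₀
  ○̄ φ = ¬ ○ ¬ φ

  -- "true" abbreviates a fixed but unspecified propositional tautology, so
  -- the notions that mention it are parametrised by that choice.
  module _ (true : Formula Φ₀) where

    false : Formula Φ₀
    false = ¬ true

    infix 8 ◇_ □_

    ◇_ □_ : Formula Φ₀ → Formula Φ₀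
    ◇ φ = true 𝓤 φ
    □ φ = ¬ ◇ ¬ φ

    -- The formulas provable in AXgen together with the given extra axioms.
    data Provable (Extra : Pred (Formula Φ₀) 0ℓ) : Pred (Formula Φ₀) 0ℓ where
      extra : ∀ {φ} → φ ∈ Extra → Provable Extra φ
      Prop  : ∀ {φ} → TautologyInstance φ → Provable Extra φ
      MP    : ∀ {φ ψ} → Provable Extra φ → Provable Extra (φ ⇒ ψ) →
              Provable Extra ψ
      T1    : ∀ φ ψ → Provable Extra (○ φ ∧ ○ (φ ⇒ ψ) ⇒ ○ ψ)
      T2′   : ∀ φ ψ → Provable Extra (φ 𝓤 ψ ⟺ ψ ∨ (φ ∧ ○̄ (φ 𝓤 ψ)))
      T3′   : ∀ φ → Provable Extra (○ φ ⟺ ○ false ∨ ○̄ φ)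
      RT1   : ∀ {φ} → Provable Extra φ → Provable Extra (○ φ)
      RT2   : ∀ {φ′ φ ψ} → Provable Extra (φ′ ⇒ ¬ ψ ∧ ○ φ′) →
              Provable Extra (φ′ ⇒ ¬ (φ 𝓤 ψ))

    AXgen AXinf AXfin : Pred (Formula Φ₀) 0ℓ
    AXgen = Provable ∅
    AXinf = Provable ｛ ¬ ○ false ｝
    AXfin = Provable ｛ ◇ ○ false ｝

-- finite n is the length of a sequence s₀ … sₙ, so that finite sequences are
-- nonempty and n is the index of the last element.
data Length : Set where
  finite   : ℕ → Length
  infinite : Length

Position : Length → Set
Position (finite n) = Fin (suc n)
Position infinite   = ℕ

index : ∀ l → Position l → ℕ
index (finite n) i = toℕ i
index infinite   i = i

IsLast : ∀ l → Position l → Set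
IsLast (finite n) i = toℕ i ≡ n
IsLast infinite   i = ⊥

record Structure (Φ₀ : Set) : Set₁ where
  field
    State : Set
    len   : Length
    σ     : Position len → State
    π     : State → Pred Φ₀ 0ℓ

  Pos : Set
  Pos = Position len

  # : Pos → ℕ
  # = index len

open Structure using (len; σ; π; Pos; #)

infix 3 ⟨_,_⟩⊨_

⟨_,_⟩⊨_ : ∀ {Φ₀} (M : Structure Φ₀) → Pos M → Formula Φ₀ → Set
⟨ M , i ⟩⊨ atom p = p ∈ π M (σ M i)
⟨ M , i ⟩⊨ ¬ φ    = Nullary.¬ (⟨ M , i ⟩⊨ φ)
⟨ M , i ⟩⊨ φ ∧ ψ  = (⟨ M , i ⟩⊨ φ) × (⟨ M , i ⟩⊨ ψ)
⟨ M , i ⟩⊨ ○ φ    =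
  IsLast (len M) i ⊎ ∃[ j ] # M j ≡ suc (# M i) × (⟨ M , j ⟩⊨ φ)
⟨ M , i ⟩⊨ φ 𝓤 ψ  =
  ∃[ j ] # M i ≤ # M j × (⟨ M , j ⟩⊨ ψ) ×
    (∀ k → # M i ≤ # M k → # M k < # M j → ⟨ M , k ⟩⊨ φ)

module _ {Φ₀ : Set} where

  𝓜 𝓜inf 𝓜fin : Pred (Structure Φ₀) 0ℓ
  𝓜      = U
  𝓜inf M = len M ≡ infinite
  𝓜fin M = ∃[ n ] len M ≡ finite n

  SoundAndComplete : Pred (Formula Φ₀) 0ℓ → Pred (Structure Φ₀) 0ℓ → Set₁
  SoundAndComplete AX C =
    ∀ φ → φ ∈ AX ⇔ (∀ M → M ∈ C → ∀ i → ⟨ M , i ⟩⊨ φ)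

{-# OPTIONS --safe #-}
-- Completeness: let L consist of ○ false and the subformulas of φ. A world is a
-- consistent conjunction of literals deciding every member of L, and x ⇝ y when
-- x ∧ ○̄ y is consistent. If a world contains A 𝓤 B, then B holds in a world
-- reachable from it, since otherwise RT2 would apply to the disjunction of all
-- reachable worlds. An unprovable φ fails in some world x. If a world with
-- ○ false is reachable from x, a path to it is a finite countermodel; if not,
-- worlds reachable from x always have successors, and an infinite path that
-- aims at the members of L in turn is a countermodel. Under Inf the first case
-- is excluded, and under Fin the second, as ◇ ○ false holds in x.

module Submission where

open import Defs
open import Axiom.ExcludedMiddle using (ExcludedMiddle)
open import Data.Bool.Base as Bool using (Bool; T)
open import Data.Bool.Properties using (T-≡; T-∧)
open import Data.Empty using (⊥-elim)
open import Data.Fin.Base using (Fin; zero; suc; toℕ)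
open import Data.Fin.Properties using (toℕ-injective; toℕ≤pred[n])
open import Data.List.Base using (List; []; _∷_; _++_; map; foldr; filter)
open import Data.List.Membership.Propositional using () renaming (_∈_ to _∈ˡ_)
open import Data.List.Membership.Propositional.Properties
  using (∈-++⁺ˡ; ∈-++⁺ʳ; ∈-++⁻; ∈-map⁺; ∈-map⁻; ∈-filter⁺; ∈-filter⁻)
open import Data.List.Relation.Binary.Subset.Propositional using (_⊆_)
open import Data.List.Relation.Unary.Any using (here; there)
open import Data.Nat.Base using (ℕ; zero; suc; _+_; _∸_; _≤_; _<_; s≤s)
open import Data.Nat.Properties
  using (suc-injective; ≤-refl; ≤-reflexive; ≤-trans; <⇒≱; n≤1+n; m≤n+m; +-suc;
         m∸n+n≡m; m≤n⇒m<n∨m≡n)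
open import Data.Product.Base using (_×_; _,_; ∃-syntax; proj₁; proj₂)
open import Data.Sum.Base as Sum using (_⊎_; inj₁; inj₂; [_,_]′)
open import Data.Unit.Base using (tt)
open import Function.Base using (id; _∘_)
open import Function.Bundles using (_⇔_; mk⇔; module Equivalence)
open import Level using (0ℓ)
open import Relation.Binary.Construct.Closure.ReflexiveTransitive
  using (Star; ε; _◅_; _◅◅_)
open import Relation.Binary.PropositionalEquality
  using (_≡_; refl; sym; trans; cong; cong₂; subst)
open import Relation.Nullary.Decidable using (Dec; yes; no; does; proof; decidable-stable)
import Relation.Nullary.Negation.Core as Nullary
open import Relation.Nullary.Reflects using (Reflects; invert; ¬-reflects; _×-reflects_)
open import Relation.Unary using (Pred; _∈_; ∅; ｛_｝; U)

open Equivalence using (to; from)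

-- Propositional tautologies in three variables

infixr 5 _∨ᵖ_
infixr 4 _⇒ᵖ_

_∨ᵖ_ _⇒ᵖ_ : PropFormula → PropFormula → PropFormula
α ∨ᵖ β = ¬ (¬ α ∧ ¬ β)
α ⇒ᵖ β = ¬ α ∨ᵖ β

pick : {X : Set} → X → X → X → ℕ → X
pick a b c 0 = a
pick a b c 1 = b
pick a b c (suc (suc _)) = c

-- Identifies all variables from the third on, so that the collapsed formula
-- is a tautology as soon as its eight-line truth table is.
collapse : PropFormula → PropFormula
collapse (var x) = pick (var 0) (var 1) (var 2) x
collapse (¬ α)   = ¬ collapse α
collapse (α ∧ β) = collapse α ∧ collapse β

eval-collapse : ∀ v α → eval v (collapse α) ≡ eval (pick (v 0) (v 1) (v 2)) α
eval-collapse v (var 0) = refl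
eval-collapse v (var 1) = refl
eval-collapse v (var (suc (suc _))) = refl
eval-collapse v (¬ α)   = cong Bool.not (eval-collapse v α)
eval-collapse v (α ∧ β) = cong₂ Bool._∧_ (eval-collapse v α) (eval-collapse v β)

collapse-[] : {Φ₀ : Set} (A B C : Formula Φ₀) (α : PropFormula) →
              α [ pick A B C ] ≡ collapse α [ pick A B C ]
collapse-[] A B C (var 0) = refl
collapse-[] A B C (var 1) = refl
collapse-[] A B C (var (suc (suc _))) = refl
collapse-[] A B C (¬ α)   = cong ¬_ (collapse-[] A B C α)
collapse-[] A B C (α ∧ β) = cong₂ _∧_ (collapse-[] A B C α) (collapse-[] A B C β)

every : (Bool → Bool) → Bool
every f = f Bool.true Bool.∧ f Bool.false

every⇒ : ∀ f → T (every f) → ∀ b → T (f b)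
every⇒ f h Bool.true  = proj₁ (to T-∧ h)
every⇒ f h Bool.false = proj₂ (to (T-∧ {f Bool.true}) h)

-- For a concrete valid `α` this evaluates to the unit type, so the proof can stay implicit wherever
-- `taut` is used.
Valid₃ : PropFormula → Set
Valid₃ α = T (every λ a → every λ b → every λ c → eval (pick a b c) α)

tautology₃ : ∀ α → Valid₃ α → Tautology (collapse α)
tautology₃ α valid v = trans (eval-collapse v α) (to T-≡
  (every⇒ (λ c → f (v 0) (v 1) c)
  (every⇒ (λ b → every λ c → f (v 0) b c)
  (every⇒ (λ a → every λ b → every λ c → f a b c) valid (v 0)) (v 1)) (v 2)))
  where
  f : Bool → Bool → Bool → Bool
  f a b c = eval (pick a b c) α

p q r : PropFormula
p = var 0
q = var 1
r = var 2

-- Until along a relation, and positions of a sequence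

-- The witness is an explicit finite chain, which turns arguments about `𝓤` into inductions.
data Until {X : Set} (_⋖_ : X → X → Set) (P Q : Pred X 0ℓ) : Pred X 0ℓ where
  now   : ∀ {x} → Q x → Until _⋖_ P Q x
  later : ∀ {x y} → P x → x ⋖ y → Until _⋖_ P Q y → Until _⋖_ P Q x

Eventually : {X : Set} → (X → X → Set) → Pred X 0ℓ → Pred X 0ℓ
Eventually _⋖_ = Until _⋖_ U

Until-map : {X Y : Set} {_⋖_ : X → X → Set} {_⋖′_ : Y → Y → Set}
            {P Q : Pred X 0ℓ} {P′ Q′ : Pred Y 0ℓ} (f : X → Y) →
            (∀ {x y} → x ⋖ y → f x ⋖′ f y) →
            (∀ {x} → P x → P′ (f x)) → (∀ {x} → Q x → Q′ (f x)) →
            ∀ {x} → Until _⋖_ P Q x → Until _⋖′_ P′ Q′ (f x)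
Until-map f ⋖⁺ P⁺ Q⁺ (now y)       = now (Q⁺ y)
Until-map f ⋖⁺ P⁺ Q⁺ (later x s u) = later (P⁺ x) (⋖⁺ s) (Until-map f ⋖⁺ P⁺ Q⁺ u)

Succ : ∀ l → Position l → Position l → Set
Succ l i j = index l j ≡ suc (index l i)

index-injective : ∀ l {i j} → index l i ≡ index l j → i ≡ j
index-injective (finite n) = toℕ-injective
index-injective infinite   = id

last-maximal : ∀ l {i} j → IsLast l i → index l j ≤ index l i
last-maximal (finite n) j last = subst (toℕ j ≤_) (sym last) (toℕ≤pred[n] j)

fin-next : ∀ n (i : Fin (suc n)) → toℕ i ≡ n ⊎ ∃[ j ] toℕ {suc n} j ≡ suc (toℕ i)
fin-next zero    zero    = inj₁ refl
fin-next (suc n) zero    = inj₂ (suc zero , refl)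
fin-next (suc n) (suc i) =
  Sum.map (cong suc) (λ (j , e) → suc j , cong suc e) (fin-next n i)

last-or-next : ∀ l i → IsLast l i ⊎ ∃[ j ] Succ l i j
last-or-next (finite n) i = fin-next n i
last-or-next infinite   i = inj₂ (suc i , refl)

module _ (l : Length) {P Q : Pred (Position l) 0ℓ} where

  private # = index l

  -- Induction on the distance `d`. When it is positive, `j` lies strictly beyond `i`, so `i` is not
  -- last and has a successor, nearer to `j` by one.
  until⁺ : ∀ d {i j} → # j ≡ d + # i → Q j →
           (∀ k → # i ≤ # k → # k < # j → P k) → Until (Succ l) P Q i
  until⁺ zero e Qj Ps = now (subst Q (index-injective l e) Qj)
  until⁺ (suc d) {i} {j} e Qj Ps with last-or-next l i
  ... | inj₁ last = ⊥-elim (<⇒≱ i<j (last-maximal l j last))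
    where i<j = subst (# i <_) (sym e) (s≤s (m≤n+m (# i) d))
  ... | inj₂ (i′ , s) =
    later (Ps i ≤-refl i<j) s
      (until⁺ d (trans e (trans (sym (+-suc d (# i))) (cong (d +_) (sym s)))) Qj
        λ k i′≤k → Ps k (≤-trans (≤-trans (n≤1+n _) (≤-reflexive (sym s))) i′≤k))
    where i<j = subst (# i <_) (sym e) (s≤s (m≤n+m (# i) d))

  until⁻ : ∀ {i} → Until (Succ l) P Q i →
           ∃[ j ] # i ≤ # j × Q j × (∀ k → # i ≤ # k → # k < # j → P k)
  until⁻ {i} (now Qi) = i , ≤-refl , Qi , λ k i≤k k<i → ⊥-elim (<⇒≱ k<i i≤k)
  until⁻ {i} (later Pi s u) with until⁻ u
  ... | j , i′≤j , Qj , Ps =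
    j , ≤-trans (n≤1+n _) (≤-trans (≤-reflexive (sym s)) i′≤j) , Qj , before
    where
    before : ∀ k → # i ≤ # k → # k < # j → P k
    before k i≤k k<j with m≤n⇒m<n∨m≡n i≤k
    ... | inj₁ i<k = Ps k (≤-trans (≤-reflexive s) i<k) k<j
    ... | inj₂ i≡k = subst P (index-injective l i≡k) Pi

module _ {Φ₀ : Set} (M : Structure Φ₀) where

  open Structure M using (len; #)

  ⊨𝓤⇔Until : ∀ φ ψ i → (⟨ M , i ⟩⊨ φ 𝓤 ψ) ⇔
               Until (Succ len) (⟨ M ,_⟩⊨ φ) (⟨ M ,_⟩⊨ ψ) i
  ⊨𝓤⇔Until φ ψ i = mk⇔
    (λ (j , i≤j , ψj , φs) → until⁺ len (# j ∸ # i) (sym (m∸n+n≡m i≤j)) ψj φs)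
    (until⁻ len)

-- Soundness

module Soundness (em : ExcludedMiddle 0ℓ) {Φ₀ : Set} (true : Formula Φ₀)
                 (true-taut : true ∈ TautologyInstance) (M : Structure Φ₀) where

  open Structure M using (len)

  stable : {A : Set} → Nullary.¬ Nullary.¬ A → A
  stable = decidable-stable em

  ⇒⁺ : ∀ {i} φ ψ → (⟨ M , i ⟩⊨ φ → ⟨ M , i ⟩⊨ ψ) → ⟨ M , i ⟩⊨ φ ⇒ ψ
  ⇒⁺ φ ψ f (¬¬φ , ¬ψ) = ¬¬φ (¬ψ ∘ f)

  ⇒⁻ : ∀ {i} φ ψ → ⟨ M , i ⟩⊨ φ ⇒ ψ → ⟨ M , i ⟩⊨ φ → ⟨ M , i ⟩⊨ ψ
  ⇒⁻ φ ψ h φi = stable λ ¬ψ → h ((λ ¬φ → ¬φ φi) , ¬ψ)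

  ∨⁺ : ∀ {i} φ ψ → (⟨ M , i ⟩⊨ φ) ⊎ (⟨ M , i ⟩⊨ ψ) → ⟨ M , i ⟩⊨ φ ∨ ψ
  ∨⁺ φ ψ h (¬φ , ¬ψ) = [ ¬φ , ¬ψ ]′ h

  ∨⁻ : ∀ {i} φ ψ → ⟨ M , i ⟩⊨ φ ∨ ψ → (⟨ M , i ⟩⊨ φ) ⊎ (⟨ M , i ⟩⊨ ψ)
  ∨⁻ φ ψ h = stable λ ¬φ∨ψ → h (¬φ∨ψ ∘ inj₁ , ¬φ∨ψ ∘ inj₂)

  -- Deciding each `θ x` at `i` by excluded middle gives a valuation, and `eval` follows the truth
  -- clauses for negation and conjunction.
  substitution : ∀ i (θ : ℕ → Formula Φ₀) α →
    Reflects (⟨ M , i ⟩⊨ α [ θ ]) (eval (λ x → does (em {⟨ M , i ⟩⊨ θ x})) α)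
  substitution i θ (var x) = proof em
  substitution i θ (¬ α)   = ¬-reflects (substitution i θ α)
  substitution i θ (α ∧ β) = substitution i θ α ×-reflects substitution i θ β

  tautology-true : ∀ {φ} i → φ ∈ TautologyInstance → ⟨ M , i ⟩⊨ φ
  tautology-true i (α , θ , taut , refl) =
    invert (subst (Reflects _) (taut _) (substitution i θ α))

  Succ⇒¬IsLast : ∀ {i j} → Succ len i j → Nullary.¬ IsLast len i
  Succ⇒¬IsLast {j = j} s last = <⇒≱ (≤-reflexive (sym s)) (last-maximal len j last)

  Succ-unique : ∀ {i j k} → Succ len i j → Succ len i k → j ≡ k
  Succ-unique s t = index-injective len (trans s (sym t))

  ○⁻ : ∀ {i j} φ → Succ len i j → ⟨ M , i ⟩⊨ ○ φ → ⟨ M , j ⟩⊨ φ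
  ○⁻ φ s (inj₁ last)         = ⊥-elim (Succ⇒¬IsLast s last)
  ○⁻ φ s (inj₂ (k , t , φk)) = subst (⟨ M ,_⟩⊨ φ) (Succ-unique t s) φk

  ○̄⁺ : ∀ {i j} φ → Succ len i j → ⟨ M , j ⟩⊨ φ → ⟨ M , i ⟩⊨ ○̄ φ
  ○̄⁺ φ s φj h = ○⁻ (¬ φ) s h φj

  ○̄⁻ : ∀ {i} φ → ⟨ M , i ⟩⊨ ○̄ φ → ∃[ j ] Succ len i j × (⟨ M , j ⟩⊨ φ)
  ○̄⁻ {i} φ h with last-or-next len i
  ... | inj₁ last    = ⊥-elim (h (inj₁ last))
  ... | inj₂ (j , s) = j , s , stable λ ¬φ → h (inj₂ (j , s , ¬φ))

  unfold⁺ : ∀ φ ψ i → ⟨ M , i ⟩⊨ φ 𝓤 ψ → ⟨ M , i ⟩⊨ ψ ∨ (φ ∧ ○̄ (φ 𝓤 ψ))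
  unfold⁺ φ ψ i h = ∨⁺ ψ (φ ∧ ○̄ (φ 𝓤 ψ)) (go (to (⊨𝓤⇔Until M φ ψ i) h))
    where
    go : Until (Succ len) (⟨ M ,_⟩⊨ φ) (⟨ M ,_⟩⊨ ψ) i →
         (⟨ M , i ⟩⊨ ψ) ⊎ (⟨ M , i ⟩⊨ φ ∧ ○̄ (φ 𝓤 ψ))
    go (now ψi)              = inj₁ ψi
    go (later {y = j} φi s u) =
      inj₂ (φi , ○̄⁺ (φ 𝓤 ψ) s (from (⊨𝓤⇔Until M φ ψ j) u))

  unfold⁻ : ∀ φ ψ i → ⟨ M , i ⟩⊨ ψ ∨ (φ ∧ ○̄ (φ 𝓤 ψ)) → ⟨ M , i ⟩⊨ φ 𝓤 ψ
  unfold⁻ φ ψ i h with ∨⁻ ψ (φ ∧ ○̄ (φ 𝓤 ψ)) h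
  ... | inj₁ ψi       = from (⊨𝓤⇔Until M φ ψ i) (now ψi)
  ... | inj₂ (φi , n) with ○̄⁻ (φ 𝓤 ψ) n
  ...   | j , s , u = from (⊨𝓤⇔Until M φ ψ i) (later φi s (to (⊨𝓤⇔Until M φ ψ j) u))

  sound : ∀ {Extra φ} → (∀ {χ} → χ ∈ Extra → ∀ i → ⟨ M , i ⟩⊨ χ) →
          Provable true Extra φ → ∀ i → ⟨ M , i ⟩⊨ φ
  sound ex (extra e) = ex e
  sound ex (Prop t) i = tautology-true i t
  sound ex (MP {φ} {ψ} d e) i = ⇒⁻ φ ψ (sound ex e i) (sound ex d i)
  sound ex (T1 φ ψ) i = ⇒⁺ (○ φ ∧ ○ (φ ⇒ ψ)) (○ ψ) λ
    { (inj₁ last , _) → inj₁ last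
    ; (inj₂ (j , s , φj) , h) → inj₂ (j , s , ⇒⁻ φ ψ (○⁻ (φ ⇒ ψ) s h) φj) }
  sound ex (T2′ φ ψ) i =
    ⇒⁺ (φ 𝓤 ψ) (ψ ∨ (φ ∧ ○̄ (φ 𝓤 ψ))) (unfold⁺ φ ψ i) ,
    ⇒⁺ (ψ ∨ (φ ∧ ○̄ (φ 𝓤 ψ))) (φ 𝓤 ψ) (unfold⁻ φ ψ i)
  sound ex (T3′ φ) i =
    ⇒⁺ (○ φ) (○ false true ∨ ○̄ φ) (λ
      { (inj₁ last) → ∨⁺ (○ false true) (○̄ φ) (inj₁ (inj₁ last))
      ; (inj₂ (j , s , φj)) → ∨⁺ (○ false true) (○̄ φ) (inj₂ (○̄⁺ φ s φj)) }) ,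
    ⇒⁺ (○ false true ∨ ○̄ φ) (○ φ) (λ h → case (∨⁻ (○ false true) (○̄ φ) h))
    where
    case : (⟨ M , i ⟩⊨ ○ false true) ⊎ (⟨ M , i ⟩⊨ ○̄ φ) → ⟨ M , i ⟩⊨ ○ φ
    case (inj₁ (inj₁ last))        = inj₁ last
    -- `false` holds nowhere, since `true` is a tautology instance; hence `○ false` can only stem
    -- from a last position.
    case (inj₁ (inj₂ (j , s , f))) = ⊥-elim (f (tautology-true j true-taut))
    case (inj₂ h)                  = inj₂ (○̄⁻ φ h)
  sound ex (RT1 d) i with last-or-next len i
  ... | inj₁ last    = inj₁ last
  ... | inj₂ (j , s) = inj₂ (j , s , sound ex d j)
  sound ex (RT2 {φ′} {φ} {ψ} d) i =
    ⇒⁺ φ′ (¬ (φ 𝓤 ψ)) λ φ′i u → go (to (⊨𝓤⇔Until M φ ψ i) u) φ′i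
    where
    invariant : ∀ j → ⟨ M , j ⟩⊨ φ′ → ⟨ M , j ⟩⊨ ¬ ψ ∧ ○ φ′
    invariant j = ⇒⁻ φ′ (¬ ψ ∧ ○ φ′) (sound ex d j)

    -- Along the chain leading to `ψ`, the invariant `φ′` is handed on from each position to the
    -- next and finally excludes `ψ`.
    go : ∀ {j} → Until (Succ len) (⟨ M ,_⟩⊨ φ) (⟨ M ,_⟩⊨ ψ) j →
         Nullary.¬ (⟨ M , j ⟩⊨ φ′)
    go (now ψj)      φ′j = proj₁ (invariant _ φ′j) ψj
    go (later _ s u) φ′j = go u (○⁻ φ′ s (proj₂ (invariant _ φ′j)))

-- Finite worlds

module Worlds (em : ExcludedMiddle 0ℓ) {Φ₀ : Set} (true : Formula Φ₀)
              (true-taut : true ∈ TautologyInstance)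
              (Extra : Pred (Formula Φ₀) 0ℓ) where

  infix 2 ⊢₀_ _⊢_

  ⊢₀_ : Pred (Formula Φ₀) 0ℓ
  ⊢₀ A = Provable true Extra A

  _⊢_ : Formula Φ₀ → Pred (Formula Φ₀) 0ℓ
  A ⊢ B = ⊢₀ A ⇒ B

  -- Derived propositional and temporal rules

  taut : ∀ α {_ : Valid₃ α} A B C → ⊢₀ α [ pick A B C ]
  taut α {h} A B C = Prop (collapse α , _ , tautology₃ α h , collapse-[] A B C α)

  -- Propositional reasoning is done once here and used for provability, for the consequences of
  -- `X`, and for the formulas `A` with `X ⊢ ○ A`.
  record Theory (F : Pred (Formula Φ₀) 0ℓ) : Set where
    field
      thm : ∀ {A} → ⊢₀ A → F A
      mp  : ∀ {A B} → F (A ⇒ B) → F A → F B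

    apply : ∀ {A B} → A ⊢ B → F A → F B
    apply d = mp (thm d)

    pair : ∀ {A B} → F A → F B → F (A ∧ B)
    pair {A} {B} a b = mp (apply (taut (p ⇒ᵖ q ⇒ᵖ p ∧ q) A B A) a) b

    efq : ∀ {A B} → F (¬ A) → F A → F B
    efq {A} {B} n a = mp (apply (taut (¬ p ⇒ᵖ p ⇒ᵖ q) A B A) n) a

    modus-tollens : ∀ {A B} → A ⊢ B → F (¬ B) → F (¬ A)
    modus-tollens {A} {B} d n = mp (apply (taut (¬ q ⇒ᵖ (p ⇒ᵖ q) ⇒ᵖ ¬ p) A B A) n) (thm d)

    ∨-resolve : ∀ {A B} → F (A ∨ B) → F (¬ A) → F B
    ∨-resolve {A} {B} d n = mp (apply (taut (p ∨ᵖ q ⇒ᵖ ¬ p ⇒ᵖ q) A B A) d) n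

  open Theory

  ⊢-theory : Theory ⊢₀_
  ⊢-theory .thm = id
  ⊢-theory .mp d e = MP e d

  weaken : ∀ {A B} → ⊢₀ B → A ⊢ B
  weaken {A} {B} d = MP d (taut (p ⇒ᵖ q ⇒ᵖ p) B A A)

  ⊢-refl : ∀ A → A ⊢ A
  ⊢-refl A = taut (p ⇒ᵖ p) A A A

  ∧-fst : ∀ A B → A ∧ B ⊢ A
  ∧-fst A B = taut (p ∧ q ⇒ᵖ p) A B A

  ∧-snd : ∀ A B → A ∧ B ⊢ B
  ∧-snd A B = taut (p ∧ q ⇒ᵖ q) A B A

  ⊢-true : ⊢₀ true
  ⊢-true = Prop true-taut

  false⊢ : ∀ A → false true ⊢ A
  false⊢ A = MP ⊢-true (taut (p ⇒ᵖ ¬ p ⇒ᵖ q) true A A)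

  hyp-theory : ∀ X → Theory (X ⊢_)
  hyp-theory X .thm = weaken
  hyp-theory X .mp {A} {B} d e =
    MP e (MP d (taut ((p ⇒ᵖ q ⇒ᵖ r) ⇒ᵖ (p ⇒ᵖ q) ⇒ᵖ (p ⇒ᵖ r)) X A B))

  ⊢-trans : ∀ {A B C} → A ⊢ B → B ⊢ C → A ⊢ C
  ⊢-trans {A} d e = apply (hyp-theory A) e d

  contrapose : ∀ {A B} → A ⊢ ¬ B → B ⊢ ¬ A
  contrapose {A} {B} d = MP d (taut ((p ⇒ᵖ ¬ q) ⇒ᵖ (q ⇒ᵖ ¬ p)) A B A)

  ∨-case : ∀ {A B C} → A ⊢ C → B ⊢ C → A ∨ B ⊢ C
  ∨-case {A} {B} {C} d e =
    MP e (MP d (taut ((p ⇒ᵖ r) ⇒ᵖ (q ⇒ᵖ r) ⇒ᵖ (p ∨ᵖ q ⇒ᵖ r)) A B C))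

  -- RT1 and T1 make `○` a normal modality, so one can reason propositionally beneath it.
  ○-theory : ∀ X → Theory (λ A → X ⊢ ○ A)
  ○-theory X .thm d = weaken (RT1 d)
  ○-theory X .mp {A} {B} d e =
    apply (hyp-theory X) (T1 A B) (pair (hyp-theory X) e d)

  ○-mono : ∀ {A B} → A ⊢ B → ○ A ⊢ ○ B
  ○-mono {A} d = apply (○-theory (○ A)) d (⊢-refl (○ A))

  ○̄⊢○ : ∀ A → ○̄ A ⊢ ○ A
  ○̄⊢○ A = ⊢-trans (taut (q ⇒ᵖ p ∨ᵖ q) (○ false true) (○̄ A) A) (MP (T3′ A) (∧-snd _ _))

  -- Contraposing `○ ¬ ¬ A ⊢ ○ A` turns `¬ ○ A` into `¬ ○ ¬ ¬ A`, which is `○̄ ¬ A`; T3′ then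
  -- weakens strong next to weak next.
  ¬○⊢○¬ : ∀ A → ¬ ○ A ⊢ ○ ¬ A
  ¬○⊢○¬ A = ⊢-trans (modus-tollens (hyp-theory (¬ ○ A)) (○-mono dne) (⊢-refl _)) (○̄⊢○ (¬ A))
    where
    dne : ¬ ¬ A ⊢ A
    dne = taut (¬ ¬ p ⇒ᵖ p) A A A

  module _ {X A B : Formula Φ₀} where

    private module H = Theory (hyp-theory X)

    𝓤-now : X ⊢ B → X ⊢ A 𝓤 B
    𝓤-now d = H.apply (MP (T2′ A B) (∧-snd _ _))
      (H.apply (taut (p ⇒ᵖ p ∨ᵖ q) B (A ∧ ○̄ (A 𝓤 B)) B) d)

    𝓤-unfold : X ⊢ A 𝓤 B → X ⊢ ¬ B → X ⊢ A ∧ ○̄ (A 𝓤 B)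
    𝓤-unfold u = H.∨-resolve (H.apply (MP (T2′ A B) (∧-fst _ _)) u)

    -- By T2′, `¬ (A 𝓤 B)` refutes `A ∧ ○̄ (A 𝓤 B)`. The second conjunct is literally `¬ N`, so `A`
    -- leaves `N`.
    ¬𝓤-step : X ⊢ ¬ (A 𝓤 B) → X ⊢ A → X ⊢ ○ ¬ (A 𝓤 B)
    ¬𝓤-step n a = H.mp (H.apply (taut (¬ (p ∧ ¬ q) ⇒ᵖ p ⇒ᵖ q) A N N)
      (H.modus-tollens (⊢-trans (taut (q ⇒ᵖ p ∨ᵖ q) B (A ∧ ¬ N) B) (MP (T2′ A B) (∧-snd _ _))) n)) a
      where N = ○ ¬ (A 𝓤 B)

  -- Finite disjunctions and conjunctions of literals

  ⋁ : List (Formula Φ₀) → Formula Φ₀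
  ⋁ = foldr _∨_ (false true)

  ⋁⁺ : ∀ {A As} → A ∈ˡ As → A ⊢ ⋁ As
  ⋁⁺ {A} {As = B ∷ As} (here refl) = taut (p ⇒ᵖ p ∨ᵖ q) A (⋁ As) A
  ⋁⁺ {A} {As = B ∷ As} (there A∈)  =
    ⊢-trans (⋁⁺ A∈) (taut (q ⇒ᵖ p ∨ᵖ q) B (⋁ As) A)

  ⋁⁻ : ∀ {D} As → (∀ {A} → A ∈ˡ As → A ⊢ D) → ⋁ As ⊢ D
  ⋁⁻ []       f = false⊢ _
  ⋁⁻ (A ∷ As) f = ∨-case (f (here refl)) (⋁⁻ As (f ∘ there))

  worlds : List (Formula Φ₀) → List (Formula Φ₀)
  worlds []      = true ∷ []
  worlds (A ∷ L) = map (A ∧_) (worlds L) ++ map (¬ A ∧_) (worlds L)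

  worlds-decide : ∀ L {χ A} → χ ∈ˡ worlds L → A ∈ˡ L → (χ ⊢ A) ⊎ (χ ⊢ ¬ A)
  worlds-decide (B ∷ L) χ∈ A∈ with ∈-++⁻ (map (B ∧_) (worlds L)) χ∈
  worlds-decide (B ∷ L) χ∈ A∈ | inj₁ m with ∈-map⁻ (B ∧_) m
  worlds-decide (B ∷ L) χ∈ (here refl) | inj₁ m | χ′ , χ′∈ , refl = inj₁ (∧-fst _ _)
  worlds-decide (B ∷ L) χ∈ (there A∈)  | inj₁ m | χ′ , χ′∈ , refl =
    Sum.map (⊢-trans (∧-snd _ _)) (⊢-trans (∧-snd _ _)) (worlds-decide L χ′∈ A∈)
  worlds-decide (B ∷ L) χ∈ A∈ | inj₂ m with ∈-map⁻ (¬ B ∧_) m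
  worlds-decide (B ∷ L) χ∈ (here refl) | inj₂ m | χ′ , χ′∈ , refl = inj₂ (∧-fst _ _)
  worlds-decide (B ∷ L) χ∈ (there A∈)  | inj₂ m | χ′ , χ′∈ , refl =
    Sum.map (⊢-trans (∧-snd _ _)) (⊢-trans (∧-snd _ _)) (worlds-decide L χ′∈ A∈)

  -- A case split on `A` and `¬ A` for each list member. Any theory is allowed so that the split
  -- also works beneath `○`.
  worlds-cover : ∀ {F} → Theory F → ∀ L {D} →
                 (∀ {χ} → χ ∈ˡ worlds L → F (χ ⇒ D)) → F D
  worlds-cover T []      f = mp T (f (here refl)) (thm T ⊢-true)
  worlds-cover T (A ∷ L) {D} f = worlds-cover T L λ {χ} χ∈ →
    mp T (apply T (taut ((p ∧ q ⇒ᵖ r) ⇒ᵖ (¬ p ∧ q ⇒ᵖ r) ⇒ᵖ (q ⇒ᵖ r)) A χ D)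
            (f (∈-++⁺ˡ (∈-map⁺ (A ∧_) χ∈))))
         (f (∈-++⁺ʳ (map (A ∧_) (worlds L)) (∈-map⁺ (¬ A ∧_) χ∈)))

  World : List (Formula Φ₀) → Set
  World L = ∃[ χ ] χ ∈ˡ worlds L × Nullary.¬ (⊢₀ ¬ χ)

  -- Successors and reachability of worlds

  module Successors {L : List (Formula Φ₀)} where

    infix 4 _⇝_ _⊩_

    _⊩_ : World L → Pred (Formula Φ₀) 0ℓ
    x ⊩ A = proj₁ x ⊢ A

    -- x ∧ ○̄ y is consistent.
    _⇝_ : World L → World L → Set
    x ⇝ y = Nullary.¬ (x ⊩ ○ ¬ proj₁ y)

    Reach : Formula Φ₀ → Pred (World L) 0ℓ
    Reach A x = ∃[ y ] Star _⇝_ x y × y ⊩ A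

    consistent : ∀ {A} (x : World L) → x ⊩ ¬ A → Nullary.¬ (x ⊩ A)
    consistent (χ , _ , con) n d =
      con (MP (efq (hyp-theory χ) n d) (taut ((p ⇒ᵖ ¬ p) ⇒ᵖ ¬ p) χ χ χ))

    decide : ∀ {A} (x : World L) → A ∈ˡ L → x ⊩ A ⊎ x ⊩ ¬ A
    decide (χ , χ∈ , _) = worlds-decide L χ∈

    -- If `y` proved `¬ A`, then `A` would refute `y`, and `x ⊩ ○ A` would give `x ⊩ ○ ¬ y`. Nothing
    -- stronger follows yet, as `y` need not decide `A`.
    ⇝-○ : ∀ {A} x y → x ⇝ y → x ⊩ ○ A → Nullary.¬ (y ⊩ ¬ A)
    ⇝-○ x y x⇝y d n = x⇝y (⊢-trans d (○-mono (contrapose n)))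

    ⇝-○⁺ : ∀ {A} x y → A ∈ˡ L → x ⇝ y → x ⊩ ○ A → y ⊩ A
    ⇝-○⁺ x y A∈ x⇝y d = [ id , ⊥-elim ∘ ⇝-○ x y x⇝y d ]′ (decide y A∈)

    ⇝-○¬ : ∀ {A} x y → A ∈ˡ L → x ⇝ y → x ⊩ ○ ¬ A → y ⊩ ¬ A
    ⇝-○¬ {A} x y A∈ x⇝y d with decide y A∈
    ... | inj₁ a = ⊥-elim (⇝-○ x y x⇝y d (⊢-trans a (taut (p ⇒ᵖ ¬ ¬ p) A A A)))
    ... | inj₂ n = n

    last⇒¬⇝ : ∀ x y → x ⊩ ○ false true → Nullary.¬ (x ⇝ y)
    last⇒¬⇝ x y last x⇝y = x⇝y (⊢-trans last (○-mono (false⊢ _)))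

    -- Cases over all worlds beneath `○`: a conjunction is either refuted there or is a successor of
    -- `x`, where `D` is given.
    ○-intro : ∀ {D} x → (∀ y → x ⇝ y → y ⊩ D) → x ⊩ ○ D
    ○-intro {D} x@(χ , _) f = worlds-cover (○-theory χ) L cases
      where
      cases : ∀ {χ′} → χ′ ∈ˡ worlds L → χ ⊢ ○ (χ′ ⇒ D)
      cases {χ′} χ′∈ with em {χ ⊢ ○ ¬ χ′}
      ... | yes d = apply (○-theory χ) (taut (¬ p ⇒ᵖ p ⇒ᵖ q) χ′ D D) d
      -- `χ′` is consistent, since RT1 would turn a proof of `¬ χ′` into one of `○ ¬ χ′`.
      ... | no x⇝ = weaken (RT1 (f (χ′ , χ′∈ , x⇝ ∘ weaken ∘ RT1) x⇝))

    serial : ∀ x → Nullary.¬ (x ⊩ ○ false true) → ∃[ y ] x ⇝ y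
    serial x ¬last with em {∃[ y ] x ⇝ y}
    ... | yes s = s
    ... | no ¬s = ⊥-elim (¬last (○-intro x λ y x⇝y → ⊥-elim (¬s (y , x⇝y))))

    -- Otherwise the disjunction of the worlds reachable from x would be an
    -- invariant to which RT2 applies.
    realise : ∀ {A B} x → B ∈ˡ L → x ⊩ A 𝓤 B → Reach B x
    realise {A} {B} x@(χ₀ , χ₀∈ , _) B∈ u with em {Reach B x}
    ... | yes reach = reach
    ... | no ¬reach = ⊥-elim (consistent x (⊢-trans (⋁⁺ (member x ε)) refuted) u)
      where
      -- Reachability is phrased for formulas, because the finite list to be filtered consists of
      -- formulas without consistency proofs.
      Reachable : Pred (Formula Φ₀) 0ℓ
      Reachable χ = ∃[ y ] Star _⇝_ x y × proj₁ y ≡ χ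

      reachable? : ∀ χ → Dec (Reachable χ)
      reachable? χ = em

      reachables : List (Formula Φ₀)
      reachables = filter reachable? (worlds L)

      member : ∀ y → Star _⇝_ x y → proj₁ y ∈ˡ reachables
      member y x⇝*y = ∈-filter⁺ reachable? (proj₁ (proj₂ y)) (y , x⇝*y , refl)

      invariant : ∀ {χ} → χ ∈ˡ reachables → χ ⊢ ¬ B ∧ ○ ⋁ reachables
      invariant {χ} χ∈ with proj₂ (∈-filter⁻ reachable? {xs = worlds L} χ∈)
      ... | y , x⇝*y , refl = pair (hyp-theory χ)
        ([ (λ b → ⊥-elim (¬reach (y , x⇝*y , b))) , id ]′ (decide y B∈))
        (○-intro y λ z y⇝z → ⋁⁺ (member z (x⇝*y ◅◅ y⇝z ◅ ε)))

      refuted : ⋁ reachables ⊢ ¬ (A 𝓤 B)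
      refuted = RT2 (⋁⁻ reachables invariant)

    -- Inconsistent conjunctions prove everything, so if all consistent ones proved `A`, then
    -- `worlds-cover` would prove `A` outright.
    refuting-world : ∀ A → Nullary.¬ (⊢₀ A) → ∃[ x ] Nullary.¬ (x ⊩ A)
    refuting-world A ⊬A with em {∃[ x ] Nullary.¬ (x ⊩ A)}
    ... | yes r = r
    ... | no ¬r = ⊥-elim (⊬A (worlds-cover ⊢-theory L cases))
      where
      cases : ∀ {χ} → χ ∈ˡ worlds L → χ ⊢ A
      cases {χ} χ∈ = decidable-stable em λ ⊬ → ¬r ((χ , χ∈ , λ d →
        ⊬ (MP d (taut (¬ p ⇒ᵖ p ⇒ᵖ q) χ A A))) , ⊬)

eventually-last : ∀ n i → Eventually (Succ (finite n)) (IsLast (finite n)) i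
eventually-last zero    zero    = now refl
eventually-last (suc n) zero    = later {y = suc zero} tt refl
  (Until-map suc (cong suc) id (cong suc) (eventually-last n zero))
eventually-last (suc n) (suc i) =
  Until-map suc (cong suc) id (cong suc) (eventually-last n i)

-- Fair paths

module _ {X : Set} (_⇝_ : X → X → Set) where

  -- A goal that can no longer be reached counts as served.
  Served : Pred X 0ℓ → ∀ l → (Position l → X) → Pred (Position l) 0ℓ
  Served P l w i = ∃[ y ] Star _⇝_ (w i) y × P y → Eventually (Succ l) (P ∘ w) i

  record FairPath {I : Set} (P : I → Pred X 0ℓ) (goals : List I)
                  (x₀ : X) (l : Length) : Set where
    field
      state   : Position l → X
      -- Existential, because `Position l` has no uniform first element for a variable `l`.
      initial : ∃[ i ] state i ≡ x₀
      step    : ∀ {i j} → Succ l i j → state i ⇝ state j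
      fair    : ∀ {g} → g ∈ˡ goals → ∀ i → Eventually (Succ l) (Served (P g) l state) i
      final   : ∀ i → IsLast l i → ∀ y → Nullary.¬ (state i ⇝ y)

-- Finite fair paths

module FinitePath {X : Set} {_⇝_ : X → X → Set} where

  length : ∀ {x y} → Star _⇝_ x y → ℕ
  length ε       = 0
  length (_ ◅ s) = suc (length s)

  node : ∀ {x y} (s : Star _⇝_ x y) → Fin (suc (length s)) → X
  node {x} s       zero    = x
  node     (_ ◅ s) (suc i) = node s i

  node-step : ∀ {x y} (s : Star _⇝_ x y) {i j} → toℕ j ≡ suc (toℕ i) → node s i ⇝ node s j
  node-step (r ◅ ε)       {zero}  {suc zero} e = r
  node-step (r ◅ (_ ◅ _)) {zero}  {suc zero} e = r
  node-step (r ◅ s)       {suc i} {suc j}    e = node-step s (suc-injective e)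

  node-last : ∀ {x y} (s : Star _⇝_ x y) i → toℕ i ≡ length s → node s i ≡ y
  node-last ε       zero    e = refl
  node-last (_ ◅ s) (suc i) e = node-last s i (suc-injective e)

  module _ {I : Set} (P : I → Pred X 0ℓ) (goals : List I) where

    -- Every position leads to the last one, and from its stuck state only that state itself is
    -- reachable, so all goals are served there.
    finite-path : ∀ {x y} (s : Star _⇝_ x y) → (∀ z → Nullary.¬ (y ⇝ z)) →
                  FairPath _⇝_ P goals x (finite (length s))
    finite-path {y = y} s stuck = record
      { state   = node s
      ; initial = zero , refl
      ; step    = node-step s
      ; fair    = λ _ i → Until-map id id id (λ last → served last) (eventually-last (length s) i)
      ; final   = final
      }
      where
      final : ∀ i → toℕ i ≡ length s → ∀ z → Nullary.¬ (node s i ⇝ z)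
      final i last z = subst (λ x → Nullary.¬ (x ⇝ z)) (sym (node-last s i last)) (stuck z)

      served : ∀ {g i} → toℕ i ≡ length s → Served _⇝_ (P g) (finite (length s)) (node s) i
      served last (z , ε , Pz)     = now Pz
      served last (z , r ◅ _ , Pz) = ⊥-elim (final _ last _ r)

-- Infinite fair paths

module InfinitePath (em : ExcludedMiddle 0ℓ) {X I : Set} {_⇝_ : X → X → Set}
                    (P : I → Pred X 0ℓ) (goals : List I) (x₀ : X)
                    (serial : ∀ {x} → Star _⇝_ x₀ x → ∃[ y ] x ⇝ y) where

  -- A walker at the current state, heading for a target along a fixed route.
  -- On arrival it heads for the next goal of the agenda, if that can still be
  -- reached; an exhausted agenda is renewed.
  record Config : Set where
    constructor config
    field
      {current target} : X
      past   : Star _⇝_ x₀ current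
      route  : Star _⇝_ current target
      agenda : List I

  open Config

  aim : ∀ g x → ∃[ y ] Star _⇝_ x y × (∃[ z ] Star _⇝_ x z × P g z → P g y)
  aim g x with em {∃[ z ] Star _⇝_ x z × P g z}
  ... | yes (z , s , Pz) = z , s , λ _ → Pz
  ... | no ¬reach        = x , ε , ⊥-elim ∘ ¬reach

  -- Each call takes exactly one `⇝` step, also when the agenda is consulted or renewed; a new aim
  -- is chosen from the state after that step.
  advance : Config → Config
  advance (config past (r ◅ route) gs) = config (past ◅◅ r ◅ ε) route gs
  advance (config past ε []) with serial past
  ... | x , r = config (past ◅◅ r ◅ ε) ε goals
  advance (config past ε (g ∷ gs)) with serial past
  ... | x , r = config (past ◅◅ r ◅ ε) (proj₁ (proj₂ (aim g x))) gs

  advance-⇝ : ∀ c → current c ⇝ current (advance c)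
  advance-⇝ (config past (r ◅ route) gs) = r
  advance-⇝ (config past ε [])       = proj₂ (serial past)
  advance-⇝ (config past ε (g ∷ gs)) = proj₂ (serial past)

  Then : Config → Config → Set
  Then c d = advance c ≡ d

  arrive : ∀ {Q : Pred Config 0ℓ} {x y} (past : Star _⇝_ x₀ x) (route : Star _⇝_ x y) gs →
           (∀ past′ → Eventually Then Q (config {y} past′ ε gs)) →
           Eventually Then Q (config past route gs)
  arrive past ε           gs f = f past
  arrive past (r ◅ route) gs f = later tt refl (arrive _ route gs f)

  Serves : I → Pred Config 0ℓ
  Serves g c = ∃[ z ] Star _⇝_ (current c) z × P g z → Eventually Then (P g ∘ current) c

  -- `aim` picks a target satisfying the goal whenever one is reachable, and the walker keeps to its
  -- route until it arrives.
  serves-next : ∀ g gs {x} (past : Star _⇝_ x₀ x) → Serves g (advance (config past ε (g ∷ gs)))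
  serves-next g gs past reach with serial past
  ... | x , r with aim g x
  ...   | y , route , hit = arrive _ route gs λ _ → now (hit reach)

  serves-listed : ∀ {g gs x y} (past : Star _⇝_ x₀ x) (route : Star _⇝_ x y) →
                  g ∈ˡ gs → Eventually Then (Serves g) (config past route gs)
  serves-listed past route (here {xs = gs} refl) =
    arrive past route _ λ past′ → later tt refl (now (serves-next _ gs past′))
  serves-listed past route (there g∈) =
    arrive past route _ λ past′ → later tt refl (serves-listed _ _ g∈)

  -- The remaining agenda is used up whatever it contains; after renewal it lists all goals, among
  -- them `g`.
  serves : ∀ {g} → g ∈ˡ goals → ∀ gs {x y} (past : Star _⇝_ x₀ x) (route : Star _⇝_ x y) →
           Eventually Then (Serves g) (config past route gs)
  serves g∈ [] past route =
    arrive past route _ λ past′ → later tt refl (serves-listed _ _ g∈)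
  serves g∈ (h ∷ gs) past route =
    arrive past route _ λ past′ → later tt refl (serves g∈ gs _ _)

  run : ℕ → Config
  run zero    = config ε ε goals
  run (suc n) = advance (run n)

  run-eventually : ∀ {Q c} → Eventually Then Q c → ∀ i → run i ≡ c →
                   Eventually (Succ infinite) (Q ∘ run) i
  run-eventually (now Qc)         i refl = now Qc
  run-eventually (later _ refl u) i refl = later tt refl (run-eventually u (suc i) refl)

  infinite-path : FairPath _⇝_ P goals x₀ infinite
  infinite-path = record
    { state   = current ∘ run
    ; initial = 0 , refl
    ; step    = λ { {i} refl → advance-⇝ (run i) }
    ; fair    = λ g∈ i → Until-map id id id (λ {j} s reach → run-eventually (s reach) j refl)
                  (run-eventually (serves g∈ (agenda (run i)) (past (run i)) (route (run i))) i refl)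
    ; final   = λ _ ()
    }

-- Completeness

subformulas : {Φ₀ : Set} → Formula Φ₀ → List (Formula Φ₀)
subformulas φ@(atom _)  = φ ∷ []
subformulas φ@(¬ α)     = φ ∷ subformulas α
subformulas φ@(α ∧ β)   = φ ∷ subformulas α ++ subformulas β
subformulas φ@(○ α)     = φ ∷ subformulas α
subformulas φ@(α 𝓤 β)   = φ ∷ subformulas α ++ subformulas β

self∈subformulas : {Φ₀ : Set} (φ : Formula Φ₀) → φ ∈ˡ subformulas φ
self∈subformulas (atom _) = here refl
self∈subformulas (¬ _)    = here refl
self∈subformulas (_ ∧ _)  = here refl
self∈subformulas (○ _)    = here refl
self∈subformulas (_ 𝓤 _)  = here refl

module Completeness (em : ExcludedMiddle 0ℓ) {Φ₀ : Set} (true : Formula Φ₀)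
                    (true-taut : true ∈ TautologyInstance)
                    (Extra : Pred (Formula Φ₀) 0ℓ) (φ : Formula Φ₀) where

  open Worlds em true true-taut Extra

  -- `○ false` is included so that `realise` can be applied to the axiom Fin.
  L : List (Formula Φ₀)
  L = ○ false true ∷ subformulas φ

  open Successors {L}
  open Theory

  Path : World L → Length → Set
  Path = FairPath _⇝_ (λ A x → x ⊩ A) L

  -- The model on a fair path and its truth lemma

  module _ {x₀ : World L} {l : Length} (path : Path x₀ l) where

    open FairPath path

    model : Structure Φ₀
    model = record { State = World L ; len = l ; σ = state ; π = λ x a → x ⊩ atom a }

    -- By T2′, while `B` fails, `A` holds and the obligation `A 𝓤 B` passes to the next state.
    -- Either `B` turns up on the way, or `f` takes over where `Q` holds.
    walk : ∀ {A B Q i} → A 𝓤 B ∈ˡ L → B ∈ˡ L →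
           Eventually (Succ l) Q i → state i ⊩ A 𝓤 B →
           (∀ {j} → Q j → state j ⊩ A 𝓤 B →
             Until (Succ l) (λ k → state k ⊩ A) (λ k → state k ⊩ B) j) →
           Until (Succ l) (λ k → state k ⊩ A) (λ k → state k ⊩ B) i
    walk U∈ B∈ (now Qi) u f = f Qi u
    walk {A} {B} {i = i} U∈ B∈ (later {y = j} _ s e) u f with decide (state i) B∈
    ... | inj₁ b  = now b
    ... | inj₂ ¬b = later (⊢-trans next (∧-fst _ _)) s (walk U∈ B∈ e u′ f)
      where
      next = 𝓤-unfold u ¬b
      u′ : state j ⊩ A 𝓤 B
      u′ = ⇝-○⁺ (state i) (state j) U∈ (step s)
             (⊢-trans next (⊢-trans (∧-snd _ _) (○̄⊢○ _)))

    -- Two walks: one to a position where `B` is served, and, as the obligation persisting there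
    -- makes `B` reachable by `realise`, another to `B` itself.
    fulfil : ∀ {A B} i → A 𝓤 B ∈ˡ L → B ∈ˡ L → state i ⊩ A 𝓤 B →
             Until (Succ l) (λ k → state k ⊩ A) (λ k → state k ⊩ B) i
    fulfil i U∈ B∈ u = walk U∈ B∈ (fair B∈ i) u λ {j} served u′ →
      walk U∈ B∈ (served (realise (state j) B∈ u′)) u′ λ b _ → now b

    -- Induction from the end of the chain: if a state proved `¬ (A 𝓤 B)`, then `¬𝓤-step` would
    -- carry this to the next state, against the induction hypothesis.
    𝓤-provable : ∀ {A B i} → A 𝓤 B ∈ˡ L →
                 Until (Succ l) (λ k → state k ⊩ A) (λ k → state k ⊩ B) i → state i ⊩ A 𝓤 B
    𝓤-provable U∈ (now b) = 𝓤-now b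
    𝓤-provable {i = i} U∈ (later {y = j} a s u) with decide (state i) U∈
    ... | inj₁ d = d
    ... | inj₂ n = ⊥-elim (consistent (state j) ¬u (𝓤-provable U∈ u))
      where
      ¬u = ⇝-○¬ (state i) (state j) U∈ (step s) (¬𝓤-step n a)

    truth : ∀ A → subformulas A ⊆ L → ∀ i → (⟨ model , i ⟩⊨ A) ⇔ state i ⊩ A
    truth (atom a) ⊆L i = mk⇔ id id
    truth (¬ A) ⊆L i = mk⇔
      (λ ¬a → [ ⊥-elim ∘ ¬a ∘ from IH , id ]′
                (decide (state i) (⊆L (there (self∈subformulas A)))))
      (λ n → consistent (state i) n ∘ to IH)
      where IH = truth A (⊆L ∘ there) i
    truth (A ∧ B) ⊆L i = mk⇔
      (λ (a , b) → pair (hyp-theory _) (to IHA a) (to IHB b))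
      (λ d → from IHA (⊢-trans d (∧-fst _ _)) , from IHB (⊢-trans d (∧-snd _ _)))
      where
      IHA = truth A (⊆L ∘ there ∘ ∈-++⁺ˡ) i
      IHB = truth B (⊆L ∘ there ∘ ∈-++⁺ʳ (subformulas A)) i
    truth (○ A) ⊆L i = mk⇔ ○-to ○-from
      where
      A∈ = ⊆L (there (self∈subformulas A))
      IH = truth A (⊆L ∘ there)

      ○-to : ⟨ model , i ⟩⊨ ○ A → state i ⊩ ○ A
      -- By `final` a last state has no successors, so `○-intro` applies vacuously.
      ○-to (inj₁ last) = ○-intro (state i) λ y → ⊥-elim ∘ final i last y
      ○-to (inj₂ (j , s , a)) with decide (state i) (⊆L (here refl))
      ... | inj₁ d = d
      ... | inj₂ n = ⊥-elim (consistent (state j)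
        (⇝-○¬ (state i) (state j) A∈ (step s) (⊢-trans n (¬○⊢○¬ A))) (to (IH j) a))

      ○-from : state i ⊩ ○ A → ⟨ model , i ⟩⊨ ○ A
      ○-from d with last-or-next l i
      ... | inj₁ last    = inj₁ last
      ... | inj₂ (j , s) =
        inj₂ (j , s , from (IH j) (⇝-○⁺ (state i) (state j) A∈ (step s) d))
    truth (A 𝓤 B) ⊆L i = mk⇔
      (λ u → 𝓤-provable (⊆L (here refl))
        (Until-map id id (to (IHA _)) (to (IHB _)) (to (⊨𝓤⇔Until model A B i) u)))
      (λ u → from (⊨𝓤⇔Until model A B i)
        (Until-map id id (from (IHA _)) (from (IHB _)) (fulfil i (⊆L (here refl)) B∈ u)))
      where
      B∈ = ⊆L (there (∈-++⁺ʳ (subformulas A) (self∈subformulas B)))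
      IHA = truth A (⊆L ∘ there ∘ ∈-++⁺ˡ)
      IHB = truth B (⊆L ∘ there ∘ ∈-++⁺ʳ (subformulas A))

    not-valid : Nullary.¬ (x₀ ⊩ φ) → Nullary.¬ (∀ i → ⟨ model , i ⟩⊨ φ)
    not-valid x₀⊮φ valid = x₀⊮φ
      (subst (_⊩ φ) (proj₂ initial) (to (truth φ there (proj₁ initial)) (valid (proj₁ initial))))

  finite-path : ∀ {x} → Reach (○ false true) x → ∃[ n ] Path x (finite n)
  finite-path (y , s , last) = _ , FinitePath.finite-path _ L s λ z → last⇒¬⇝ y z last

  infinite-path : ∀ {x} → Nullary.¬ Reach (○ false true) x → Path x infinite
  infinite-path {x} ¬reach = InfinitePath.infinite-path em _ L x
    λ {y} s → serial y λ last → ¬reach (y , s , last)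

-- Completeness of the three systems

module _ (em : ExcludedMiddle 0ℓ) {Φ₀ : Set} (true : Formula Φ₀)
         (true-taut : true ∈ TautologyInstance) (φ : Formula Φ₀) where

  complete-gen : (∀ M → ∀ i → ⟨ M , i ⟩⊨ φ) → φ ∈ AXgen true
  complete-gen valid = decidable-stable em refute
    where
    open Completeness em true true-taut ∅ φ
    open Worlds em true true-taut ∅
    open Successors {L}

    refute : Nullary.¬ Nullary.¬ (⊢₀ φ)
    refute ⊬φ with refuting-world φ ⊬φ
    ... | x , x⊮φ with em {Reach (○ false true) x}
    ...   | yes reach = not-valid (proj₂ (finite-path reach)) x⊮φ (valid _)
    ...   | no ¬reach = not-valid (infinite-path ¬reach) x⊮φ (valid _)

  complete-inf : (∀ M → M ∈ 𝓜inf → ∀ i → ⟨ M , i ⟩⊨ φ) → φ ∈ AXinf true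
  complete-inf valid = decidable-stable em refute
    where
    open Completeness em true true-taut ｛ ¬ ○ false true ｝ φ
    open Worlds em true true-taut ｛ ¬ ○ false true ｝
    open Successors {L}

    refute : Nullary.¬ Nullary.¬ (⊢₀ φ)
    refute ⊬φ with refuting-world φ ⊬φ
    ... | x , x⊮φ = not-valid (infinite-path ¬reach) x⊮φ (valid _ refl)
      where
      ¬reach : Nullary.¬ Reach (○ false true) x
      ¬reach (y , _ , last) = consistent y (weaken (extra refl)) last

  complete-fin : (∀ M → M ∈ 𝓜fin → ∀ i → ⟨ M , i ⟩⊨ φ) → φ ∈ AXfin true
  complete-fin valid = decidable-stable em refute
    where
    open Completeness em true true-taut ｛ (◇_ true (○ false true)) ｝ φ
    open Worlds em true true-taut ｛ (◇_ true (○ false true)) ｝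
    open Successors {L}

    refute : Nullary.¬ Nullary.¬ (⊢₀ φ)
    refute ⊬φ with refuting-world φ ⊬φ
    ... | x , x⊮φ = not-valid (proj₂ (finite-path reach)) x⊮φ (valid _ (_ , refl))
      where
      reach : Reach (○ false true) x
      reach = realise x (here refl) (weaken (extra refl))

-- Validity of Inf and Fin, and the combined result

module _ (em : ExcludedMiddle 0ℓ) {Φ₀ : Set} (true : Formula Φ₀)
         (true-taut : true ∈ TautologyInstance) where

  ○false⇒IsLast : (M : Structure Φ₀) → ∀ i → ⟨ M , i ⟩⊨ ○ false true → IsLast (Structure.len M) i
  ○false⇒IsLast M i (inj₁ last)        = last
  ○false⇒IsLast M i (inj₂ (j , _ , f)) =
    ⊥-elim (f (Soundness.tautology-true em true true-taut M j true-taut))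

  inf-sound : (M : Structure Φ₀) → M ∈ 𝓜inf → ∀ i → ⟨ M , i ⟩⊨ ¬ ○ false true
  inf-sound M inf i h = ¬IsLast _ inf (○false⇒IsLast M i h)
    where
    -- The length is generalised to a variable so that its equation can be matched with `refl`.
    ¬IsLast : ∀ l → l ≡ infinite → ∀ {i} → Nullary.¬ IsLast l i
    ¬IsLast _ refl ()

  fin-sound : (M : Structure Φ₀) → M ∈ 𝓜fin → ∀ i → ⟨ M , i ⟩⊨ ◇_ true (○ false true)
  fin-sound M (n , fin) i = from (⊨𝓤⇔Until M true (○ false true) i)
    (Until-map id id (λ {j} _ → Soundness.tautology-true em true true-taut M j true-taut)
      inj₁ (last-ahead _ fin i))
    where
    last-ahead : ∀ l → l ≡ finite n → ∀ i → Eventually (Succ l) (IsLast l) i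
    last-ahead _ refl = eventually-last n

theorem1 : ExcludedMiddle 0ℓ →
    (Φ₀ : Set) (true : Formula Φ₀) → true ∈ TautologyInstance →
    SoundAndComplete (AXgen true) 𝓜 ×
    SoundAndComplete (AXinf true) 𝓜inf ×
    SoundAndComplete (AXfin true) 𝓜fin
theorem1 em Φ₀ true true-taut =
  (λ φ → mk⇔
    (λ d M _ → Soundness.sound em true true-taut M (λ ()) d)
    (λ valid → complete-gen em true true-taut φ λ M → valid M tt)) ,
  (λ φ → mk⇔
    (λ d M inf → Soundness.sound em true true-taut M
      (λ { refl → inf-sound em true true-taut M inf }) d)
    (complete-inf em true true-taut φ)) ,
  (λ φ → mk⇔
    (λ d M fin → Soundness.sound em true true-taut M
      (λ { refl → fin-sound em true true-taut M fin }) d)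
    (complete-fin em true true-taut φ))
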